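{- Let $Q$ be a prime power, let $n,k$ be integers with $n>0$ and $k\ge 0$, and let $\beta,\delta\in\mathbb{F}_{Q^2}$ satisfy $\beta^{Q+1}=1$ and $\delta\notin\mathbb{F}_Q$. Then the polynomial \[ f(x):=x^{n+k(Q+1)} \cdot \left((\delta x^{Q-1}-\beta \delta^Q)^n - \delta(x^{Q-1}-\beta)^n\right) \] permutes $\mathbb{F}_{Q^2}$ (i.e., the map $\alpha\mapsto f(\alpha)$ is a bijection of $\mathbb{F}_{Q^2}$) if and only if $\gcd(n(n+2k),Q-1)=1$. -}

module Defs where

open import Level using (Level; _⊔_)
open import Data.Nat as ℕ using (ℕ; zero; suc; _≤_)
open import Data.Nat.Primality using (Prime)
open import Data.Fin using (Fin)
open import Data.Product using (Σ; ∃; _×_)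
open import Relation.Nullary using (¬_)
open import Relation.Binary.PropositionalEquality using (_≡_)
open import Algebra.Bundles using (CommutativeRing)

IsPrimePower : ℕ → Set
IsPrimePower Q = Σ ℕ λ p → Σ ℕ λ m → Prime p × (1 ≤ m) × (Q ≡ p ℕ.^ m)

module _ {c ℓ : Level} (R : CommutativeRing c ℓ) where
  open CommutativeRing R

  pow : Carrier → ℕ → Carrier
  pow x zero    = 1#
  pow x (suc n) = x * pow x n

  record IsFiniteFieldOfOrder (N : ℕ) : Set (c ⊔ ℓ) where
    field
      1≉0      : ¬ (1# ≈ 0#)
      inverse  : ∀ x → ¬ (x ≈ 0#) → ∃ λ y → x * y ≈ 1#
      enum     : Fin N → Carrier
      enum-inj : ∀ i j → enum i ≈ enum j → i ≡ j
      enum-sur : ∀ x → ∃ λ i → enum i ≈ x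

  -- a function permutes the carrier: bijective w.r.t. the setoid equality
  -- (and respects ≈, which polynomial maps do)
  Permutes : (Carrier → Carrier) → Set (c ⊔ ℓ)
  Permutes g = (∀ x y → g x ≈ g y → x ≈ y) × (∀ y → ∃ λ x → g x ≈ y)

  fPoly : (Q n k : ℕ) (β δ : Carrier) → Carrier → Carrier
  fPoly Q n k β δ x =
    pow x (n ℕ.+ k ℕ.* (Q ℕ.+ 1)) *
      (pow (δ * pow x (Q ℕ.∸ 1) - β * pow δ Q) n
        - δ * pow (pow x (Q ℕ.∸ 1) - β) n)

{-# OPTIONS --safe #-}
module Submission where

open import Defs
open import Level using (Level)
import Data.Nat as ℕ
import Data.Nat.Properties as ℕ
open import Data.Nat using (ℕ; zero; suc; _!)
open import Data.Nat.Combinatorics using (_C_; nCk≡n!/k![n-k]!; k![n∸k]!∣n!; nCn≡1)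
open import Data.Nat.Divisibility using (_∣_; divides; ∣⇒≤; m∣m*n; ∣1⇒≡1)
open import Data.Nat.DivMod using (m/n*n≡m)
open import Data.Nat.GCD using (gcd; module Bézout; gcd-GCD; gcd[m,n]∣m; gcd[m,n]∣n)
open import Data.Nat.Primality using (Prime; euclidsLemma; prime⇒nonTrivial; ¬prime[0])
open import Data.Fin using (Fin; zero; suc; toℕ; fromℕ; inject₁; inject≤; punchIn; punchOut)
import Data.Fin.Properties as Fin
open import Data.Fin.Permutation using (Permutation; permutation; _⟨$⟩ʳ_)
open import Data.Maybe using (Maybe; map)
open import Data.Product using (∃; _×_; _,_; proj₁; proj₂)
open import Data.Sum using (_⊎_; inj₁; inj₂)
open import Data.Vec using (Vec; []; _∷_; replicate)
open import Algebra.Bundles using (CommutativeMonoid; CommutativeRing; RawRing)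
open import Function.Bundles using (_⇔_; mk⇔)
open import Relation.Nullary using (¬_; Dec; yes; no; contradiction)
open import Relation.Binary.Consequences using (dec⇒weaklyDec)
open import Relation.Binary.PropositionalEquality as ≡ using (_≡_; _≢_)

-- Write φ x = x^Q, u x = φ x - β x and v x = δ φ x - β φ(δ) x. Then
-- f x = (φ x · x)^k (v x^n - δ u x^n), where x ↦ (u x , v x) is an F_Q-linear
-- isomorphism onto W × W for the line W = {w | φ w = - φ(β) w}. Since 1 and δ are
-- independent over F_Q, f amounts to (u , v) ↦ s (u^n , v^n) with s = (φ x · x)^k in F_Q.
-- This map is homogeneous of degree n + 2k and acts on the ratio u : v by the n-th power,
-- so it is injective iff 1 is the only n-th and the only (n + 2k)-th root of 1 in F_Q.

-- The factor s varies with x, and this shapes both directions. For injectivity, the equations for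
-- u^n and v^n at two points are cross-multiplied, so that the norm factors become common to both
-- sides and only the ratio u : v is compared. For the converse, two points whose ratios differ by
-- an n-th root of 1 may still have different norm factors. Rescaling one of them by an element of
-- F_Q repairs this, provided that (n + 2k)-th powers exhaust the units of F_Q; hence n + 2k is
-- settled before n. The gcd is linked to roots of 1 by Bézout in one direction and by counting in
-- the other: if d divides both m and Q - 1, then the powers x^((Q+1)(Q-1)/d) are m-th roots of 1 in
-- F_Q. If all of these are trivial, a polynomial of degree (Q+1)(Q-1)/d vanishes at Q^2 - 1 points,
-- so d = 1.

-- Prime divisors of binomial coefficients.

prime∣!⇒≤ : ∀ {p} → Prime p → ∀ k → p ∣ k ! → p ℕ.≤ k
prime∣!⇒≤ {p} pp zero p∣1 with ∣1⇒≡1 p∣1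
... | ≡.refl = contradiction (ℕ.nonTrivial⇒n>1 1 {{prime⇒nonTrivial pp}}) ℕ.1+n≰n
prime∣!⇒≤ pp (suc k) p∣k! with euclidsLemma (suc k) (k !) pp p∣k!
... | inj₁ p∣1+k = ∣⇒≤ p∣1+k
... | inj₂ p∣k!  = ℕ.m≤n⇒m≤1+n (prime∣!⇒≤ pp k p∣k!)

-- `p` divides `p !`, which is the coefficient times `k ! * (p - k) !`, and neither of these
-- factorials is divisible by `p`.
prime∣C : ∀ {p} → Prime p → ∀ k → 0 ℕ.< k → k ℕ.< p → p ∣ p C k
prime∣C {p} pp k 0<k k<p = go (euclidsLemma (p C k) (k ! ℕ.* (p ℕ.∸ k) !) pp p∣product)
  where
  instance
    _ = k ℕ.!* (p ℕ.∸ k) !≢0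
    _ = ℕ.>-nonZero (ℕ.<-trans 0<k k<p)

  product≡p! : (p C k) ℕ.* (k ! ℕ.* (p ℕ.∸ k) !) ≡ p !
  product≡p! = ≡.trans (≡.cong (ℕ._* (k ! ℕ.* (p ℕ.∸ k) !)) (nCk≡n!/k![n-k]! (ℕ.<⇒≤ k<p)))
    (m/n*n≡m (k![n∸k]!∣n! (ℕ.<⇒≤ k<p)))

  n∣n! : ∀ n → .{{ℕ.NonZero n}} → n ∣ n !
  n∣n! (suc n) = m∣m*n (n !)

  p∣product : p ∣ (p C k) ℕ.* (k ! ℕ.* (p ℕ.∸ k) !)
  p∣product = ≡.subst (p ∣_) (≡.sym product≡p!) (n∣n! p)

  go : p ∣ p C k ⊎ p ∣ k ! ℕ.* (p ℕ.∸ k) ! → p ∣ p C k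
  go (inj₁ p∣C) = p∣C
  go (inj₂ p∣!!) with euclidsLemma (k !) ((p ℕ.∸ k) !) pp p∣!!
  ... | inj₁ p∣k! = contradiction (prime∣!⇒≤ pp k p∣k!) (ℕ.<⇒≱ k<p)
  ... | inj₂ p∣[p-k]! = contradiction (prime∣!⇒≤ pp (p ℕ.∸ k) p∣[p-k]!)
    (ℕ.<⇒≱ (ℕ.∸-monoʳ-< 0<k (ℕ.<⇒≤ k<p)))

-- Counting and translation on finite sets.

-- If `j` were missed, punching it out of the codomain would inject `Fin (suc n)` into `Fin n`.
injective⇒surjective : ∀ {n} (f : Fin n → Fin n) → (∀ i j → f i ≡ f j → i ≡ j) →
  ∀ j → ∃ λ i → f i ≡ j
injective⇒surjective {suc n} f f-inj j with Fin.any? (λ i → f i Fin.≟ j)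
... | yes hit = hit
... | no miss = contradiction (Fin.injective⇒≤ g-inj) ℕ.1+n≰n
  where
  j≢f : ∀ i → j ≢ f i
  j≢f i j≡fi = miss (i , ≡.sym j≡fi)

  g : Fin (suc n) → Fin n
  g i = punchOut (j≢f i)

  g-inj : ∀ {i i′} → g i ≡ g i′ → i ≡ i′
  g-inj {i} {i′} eq = f-inj i i′ (Fin.punchOut-injective (j≢f i) (j≢f i′) eq)

module _ {c ℓ : Level} (M : CommutativeMonoid c ℓ) where
  open CommutativeMonoid M
  open import Algebra.Properties.CommutativeMonoid.Sum M
  open import Algebra.Properties.Monoid.Mult monoid using () renaming (_×_ to _⋆_)
  open import Relation.Binary.Reasoning.Setoid setoid

  -- Translation by an invertible element permutes a list that it maps to itself.
  translate-sum : ∀ {n} (e : Fin n → Carrier) → (∀ i j → e i ≈ e j → i ≡ j) →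
    ∀ a b → a ∙ b ≈ ε →
    (∀ j → ∃ λ i → e i ≈ a ∙ e j) → (∀ j → ∃ λ i → e i ≈ b ∙ e j) →
    sum e ≈ (n ⋆ a) ∙ sum e
  translate-sum {n} e e-inj a b ab≈ε by-a by-b = begin
    sum e                              ≈⟨ sum-permute e π ⟩
    sum (λ j → e (π ⟨$⟩ʳ j))           ≈⟨ sum-cong-≋ (λ j → proj₂ (by-a j)) ⟩
    sum (λ j → a ∙ e j)                ≈⟨ ∑-distrib-+ (λ _ → a) e ⟩
    sum (λ (_ : Fin n) → a) ∙ sum e    ≈⟨ ∙-congʳ (sum-replicate n) ⟩
    (n ⋆ a) ∙ sum e                    ∎
    where
    cancel : ∀ {x y} z → x ∙ y ≈ ε → x ∙ (y ∙ z) ≈ z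
    cancel {x} {y} z xy≈ε = trans (sym (assoc x y z)) (trans (∙-congʳ xy≈ε) (identityˡ z))

    π : Permutation n n
    -- Translation by `b` undoes translation by `a`; injectivity of `e` carries this over to the
    -- indices.
    π = permutation (λ j → proj₁ (by-a j)) (λ j → proj₁ (by-b j))
      (λ j → e-inj _ _ (trans (proj₂ (by-a _))
        (trans (∙-congˡ (proj₂ (by-b j))) (cancel (e j) ab≈ε))))
      (λ j → e-inj _ _ (trans (proj₂ (by-b _))
        (trans (∙-congˡ (proj₂ (by-a j))) (cancel (e j) (trans (comm b a) ab≈ε)))))

-- Ring normalisation with integer coefficients.

-- Coefficients are formal differences of naturals, so that the solver can
-- recognise when integer multiples of 1# cancel.
module RingSolver {c ℓ : Level} (R : CommutativeRing c ℓ) where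
  open CommutativeRing R hiding (zero)
  open import Algebra.Properties.Semiring.Mult semiring
    using (×-homo-+; ×1-homo-*; ×-congˡ) renaming (_×_ to _⋆_)
  open import Algebra.Properties.Ring ring using (-‿distribˡ-*; -‿distribʳ-*)
  open import Algebra.Properties.AbelianGroup +-abelianGroup
    using (⁻¹-∙-comm; ⁻¹-involutive; ε⁻¹≈ε)
  open import Algebra.Solver.Ring.AlmostCommutativeRing
  open import Algebra.Solver.Ring.NaturalCoefficients.Default commutativeSemiring
    using (solve; _:+_; _:*_; _:=_)
  open import Relation.Binary.Reasoning.Setoid setoid

  differences : RawRing _ _
  differences = record
    { Carrier = ℕ × ℕ
    ; _≈_     = _≡_
    ; _+_     = λ (a , b) (c , d) → a ℕ.+ c , b ℕ.+ d
    ; _*_     = λ (a , b) (c , d) → a ℕ.* c ℕ.+ b ℕ.* d , a ℕ.* d ℕ.+ b ℕ.* c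
    ; -_      = λ (a , b) → b , a
    ; 0#      = 0 , 0
    ; 1#      = 1 , 0
    }

  ⟦_⟧ : ℕ × ℕ → Carrier
  ⟦ a , b ⟧ = a ⋆ 1# - b ⋆ 1#

  neg*neg : ∀ x y → x * y ≈ - x * - y
  neg*neg x y = begin
    x * y        ≈⟨ ⁻¹-involutive _ ⟨
    - - (x * y)  ≈⟨ -‿cong (-‿distribˡ-* x y) ⟩
    - (- x * y)  ≈⟨ -‿distribʳ-* (- x) y ⟩
    - x * - y    ∎

  ⟦⟧-homo : differences -Raw-AlmostCommutative⟶ fromCommutativeRing R
  ⟦⟧-homo = record
    { ⟦_⟧ = ⟦_⟧
    ; +-homo = λ (a , b) (c , d) → begin
        (a ℕ.+ c) ⋆ 1# - (b ℕ.+ d) ⋆ 1#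
          ≈⟨ +-cong (×-homo-+ 1# a c) (-‿cong (×-homo-+ 1# b d)) ⟩
        (a ⋆ 1# + c ⋆ 1#) - (b ⋆ 1# + d ⋆ 1#)
          ≈⟨ +-congˡ (⁻¹-∙-comm _ _) ⟨
        (a ⋆ 1# + c ⋆ 1#) + (- (b ⋆ 1#) + - (d ⋆ 1#))
          ≈⟨ solve 4 (λ x y z w → (x :+ z) :+ (y :+ w) := (x :+ y) :+ (z :+ w)) refl _ _ _ _ ⟩
        ⟦ a , b ⟧ + ⟦ c , d ⟧ ∎
    ; *-homo = λ (a , b) (c , d) → begin
        (a ℕ.* c ℕ.+ b ℕ.* d) ⋆ 1# - (a ℕ.* d ℕ.+ b ℕ.* c) ⋆ 1#
          ≈⟨ +-cong (×1-homo-*+* a c b d) (-‿cong (×1-homo-*+* a d b c)) ⟩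
        (a ⋆ 1# * c ⋆ 1# + b ⋆ 1# * d ⋆ 1#) - (a ⋆ 1# * d ⋆ 1# + b ⋆ 1# * c ⋆ 1#)
          ≈⟨ +-cong (+-congˡ (neg*neg _ _))
               (trans (sym (⁻¹-∙-comm _ _)) (+-cong (-‿distribʳ-* _ _) (-‿distribˡ-* _ _))) ⟩
        (a ⋆ 1# * c ⋆ 1# + - (b ⋆ 1#) * - (d ⋆ 1#)) + (a ⋆ 1# * - (d ⋆ 1#) + - (b ⋆ 1#) * c ⋆ 1#)
          ≈⟨ solve 4 (λ x y z w → (x :* z :+ y :* w) :+ (x :* w :+ y :* z) := (x :+ y) :* (z :+ w))
               refl _ _ _ _ ⟩
        ⟦ a , b ⟧ * ⟦ c , d ⟧ ∎
    ; -‿homo = λ (a , b) → begin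
        b ⋆ 1# - a ⋆ 1#         ≈⟨ +-comm _ _ ⟩
        - (a ⋆ 1#) + b ⋆ 1#     ≈⟨ +-congˡ (⁻¹-involutive _) ⟨
        - (a ⋆ 1#) - - (b ⋆ 1#) ≈⟨ ⁻¹-∙-comm _ _ ⟩
        - ⟦ a , b ⟧             ∎
    ; 0-homo = -‿inverseʳ 0#
    ; 1-homo = trans (+-cong (+-identityʳ 1#) ε⁻¹≈ε) (+-identityʳ 1#)
    }
    where
    ×1-homo-*+* : ∀ a b c d →
      (a ℕ.* b ℕ.+ c ℕ.* d) ⋆ 1# ≈ a ⋆ 1# * b ⋆ 1# + c ⋆ 1# * d ⋆ 1#
    ×1-homo-*+* a b c d = trans (×-homo-+ 1# (a ℕ.* b) (c ℕ.* d)) (+-cong (×1-homo-* a b) (×1-homo-* c d))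

  ⟦⟧-cong : ∀ a b c d → a ℕ.+ d ≡ c ℕ.+ b → ⟦ a , b ⟧ ≈ ⟦ c , d ⟧
  ⟦⟧-cong a b c d a+d≡c+b = begin
    A - B                ≈⟨ +-identityʳ _ ⟨
    (A - B) + 0#         ≈⟨ +-congˡ (-‿inverseʳ D) ⟨
    (A - B) + (D - D)    ≈⟨ solve 4 (λ x y z w → (x :+ y) :+ (z :+ w) := (x :+ z) :+ (y :+ w)) refl _ _ _ _ ⟩
    (A + D) + (- B - D)  ≈⟨ +-congʳ (trans (sym (×-homo-+ 1# a d))
                              (trans (×-congˡ a+d≡c+b) (×-homo-+ 1# c b))) ⟩
    (C + B) + (- B - D)  ≈⟨ solve 4 (λ x y z w → (x :+ y) :+ (z :+ w) := (x :+ w) :+ (y :+ z)) refl _ _ _ _ ⟩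
    (C - D) + (B - B)    ≈⟨ +-congˡ (-‿inverseʳ B) ⟩
    (C - D) + 0#         ≈⟨ +-identityʳ _ ⟩
    C - D                ∎
    where
    A = a ⋆ 1#
    B = b ⋆ 1#
    C = c ⋆ 1#
    D = d ⋆ 1#

  -- The test is crosswise, as for integers: componentwise equality would separate `(1 , 1)` from
  -- `(0 , 0)` and so miss cancellations.
  _coeff≟_ : ∀ x y → Maybe (⟦ x ⟧ ≈ ⟦ y ⟧)
  (a , b) coeff≟ (c , d) = map (⟦⟧-cong a b c d) (dec⇒weaklyDec ℕ._≟_ (a ℕ.+ d) (c ℕ.+ b))

  open import Algebra.Solver.Ring differences (fromCommutativeRing R) ⟦⟧-homo _coeff≟_ public
    using (solve; _:+_; _:*_; _:-_; :-_; _:=_)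

module CommutativeRingTheory {c ℓ : Level} (R : CommutativeRing c ℓ) where
  open CommutativeRing R hiding (zero)
  open import Algebra.Properties.CommutativeSemiring.Exp commutativeSemiring public
  open import Algebra.Properties.Semiring.Mult semiring
    using (×-assoc-*; ×-congʳ; ×-congˡ; ×1-homo-*; ×-homo-1) renaming (_×_ to _⋆_)
  open import Algebra.Properties.Semiring.Sum semiring
    using (sum; sum-init-last; sum-cong-≋; sum-replicate-zero)
  open import Algebra.Properties.CommutativeSemiring.Binomial commutativeSemiring
    using () renaming (theorem to binomial-theorem)
  open import Relation.Binary.Reasoning.Setoid setoid

  -- Powers and roots of unity in a commutative ring.

  pow≡^ : ∀ x n → pow R x n ≡ x ^ n
  pow≡^ x zero    = ≡.refl
  pow≡^ x (suc n) = ≡.cong (x *_) (pow≡^ x n)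

  1^ : ∀ n → 1# ^ n ≈ 1#
  1^ zero    = refl
  1^ (suc n) = trans (*-identityˡ _) (1^ n)

  ^-comm : ∀ x m n → (x ^ m) ^ n ≈ (x ^ n) ^ m
  ^-comm x m n = begin
    (x ^ m) ^ n    ≈⟨ ^-assocʳ x m n ⟩
    x ^ (m ℕ.* n)  ≈⟨ ^-congʳ x (ℕ.*-comm m n) ⟩
    x ^ (n ℕ.* m)  ≈⟨ ^-assocʳ x n m ⟨
    (x ^ n) ^ m    ∎

  ^≈1⇒^*≈1 : ∀ {x} m k → x ^ m ≈ 1# → x ^ (k ℕ.* m) ≈ 1#
  ^≈1⇒^*≈1 {x} m k x^m≈1 = begin
    x ^ (k ℕ.* m)  ≈⟨ ^-congʳ x (ℕ.*-comm k m) ⟩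
    x ^ (m ℕ.* k)  ≈⟨ ^-assocʳ x m k ⟨
    (x ^ m) ^ k    ≈⟨ ^-congˡ k x^m≈1 ⟩
    1# ^ k         ≈⟨ 1^ k ⟩
    1#             ∎

  ^gcd≈1 : ∀ {x} m n → x ^ m ≈ 1# → x ^ n ≈ 1# → x ^ gcd m n ≈ 1#
  ^gcd≈1 {x} m n x^m≈1 x^n≈1 with Bézout.identity (gcd-GCD m n)
  ... | Bézout.+- a b d+bn≡am = begin
    x ^ gcd m n                  ≈⟨ *-identityʳ _ ⟨
    x ^ gcd m n * 1#             ≈⟨ *-congˡ (^≈1⇒^*≈1 n b x^n≈1) ⟨
    x ^ gcd m n * x ^ (b ℕ.* n)  ≈⟨ ^-homo-* x (gcd m n) (b ℕ.* n) ⟨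
    x ^ (gcd m n ℕ.+ b ℕ.* n)    ≈⟨ ^-congʳ x d+bn≡am ⟩
    x ^ (a ℕ.* m)                ≈⟨ ^≈1⇒^*≈1 m a x^m≈1 ⟩
    1#                           ∎
  ... | Bézout.-+ a b d+am≡bn = begin
    x ^ gcd m n                  ≈⟨ *-identityʳ _ ⟨
    x ^ gcd m n * 1#             ≈⟨ *-congˡ (^≈1⇒^*≈1 m a x^m≈1) ⟨
    x ^ gcd m n * x ^ (a ℕ.* m)  ≈⟨ ^-homo-* x (gcd m n) (a ℕ.* m) ⟨
    x ^ (gcd m n ℕ.+ a ℕ.* m)    ≈⟨ ^-congʳ x d+am≡bn ⟩
    x ^ (b ℕ.* n)                ≈⟨ ^≈1⇒^*≈1 n b x^n≈1 ⟩
    1#                           ∎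

  -- The exponent of the root is an inverse of m modulo M + 1.
  coprime⇒root : ∀ m M {r} → gcd m (suc M) ≡ 1 → r ^ suc M ≈ 1# →
    ∃ λ s → s ^ suc M ≈ 1# × s ^ m ≈ r
  coprime⇒root m M {r} gcd≡1 r^M≈1
    with ≡.subst (λ d → Bézout.Identity d m (suc M)) gcd≡1 (Bézout.identity (gcd-GCD m (suc M)))
  ... | Bézout.+- a b 1+bM≡am = r ^ a , trans (^-comm r a (suc M)) (trans (^-congˡ a r^M≈1) (1^ a)) , (begin
    (r ^ a) ^ m              ≈⟨ ^-assocʳ r a m ⟩
    r ^ (a ℕ.* m)            ≈⟨ ^-congʳ r 1+bM≡am ⟨
    r * r ^ (b ℕ.* suc M)    ≈⟨ *-congˡ (^≈1⇒^*≈1 (suc M) b r^M≈1) ⟩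
    r * 1#                   ≈⟨ *-identityʳ r ⟩
    r                        ∎)
  -- Here `(r ^ a) ^ m` is the inverse of `r`, so the root is the inverse of `r ^ a`. Since `r ^ a`
  -- has order dividing `suc M`, that inverse is its `M`-th power.
  ... | Bézout.-+ a b 1+am≡bM = (r ^ a) ^ M , s^M≈1 , (begin
    s ^ m                          ≈⟨ *-identityˡ _ ⟨
    1# * s ^ m                     ≈⟨ *-congʳ rr^am≈1 ⟨
    r * (r ^ a) ^ m * s ^ m        ≈⟨ *-assoc r _ _ ⟩
    r * ((r ^ a) ^ m * s ^ m)      ≈⟨ *-congˡ (^-distrib-* (r ^ a) s m) ⟨
    r * (r ^ a * s) ^ m            ≈⟨ *-congˡ (^-congˡ m r^aM≈1) ⟩
    r * 1# ^ m                     ≈⟨ *-congˡ (1^ m) ⟩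
    r * 1#                         ≈⟨ *-identityʳ r ⟩
    r                              ∎)
    where
    s = (r ^ a) ^ M

    r^aM≈1 : (r ^ a) ^ suc M ≈ 1#
    r^aM≈1 = trans (^-comm r a (suc M)) (trans (^-congˡ a r^M≈1) (1^ a))

    s^M≈1 : s ^ suc M ≈ 1#
    s^M≈1 = trans (^-comm (r ^ a) M (suc M)) (trans (^-congˡ M r^aM≈1) (1^ M))

    rr^am≈1 : r * (r ^ a) ^ m ≈ 1#
    rr^am≈1 = begin
      r * (r ^ a) ^ m    ≈⟨ *-congˡ (^-assocʳ r a m) ⟩
      r ^ suc (a ℕ.* m)  ≈⟨ ^-congʳ r 1+am≡bM ⟩
      r ^ (b ℕ.* suc M)  ≈⟨ ^≈1⇒^*≈1 (suc M) b r^M≈1 ⟩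
      1#                 ∎

  -- Additivity of the Frobenius map.

  module _ {p : ℕ} (p-prime : Prime p) (p≈0 : p ⋆ 1# ≈ 0#) where

    p∣⇒⋆≈0 : ∀ {m} x → p ∣ m → m ⋆ x ≈ 0#
    p∣⇒⋆≈0 {m} x (divides q m≡qp) = begin
      m ⋆ x                  ≈⟨ ×-congˡ m≡qp ⟩
      (q ℕ.* p) ⋆ x          ≈⟨ ×-congʳ (q ℕ.* p) (*-identityˡ x) ⟨
      (q ℕ.* p) ⋆ (1# * x)   ≈⟨ ×-assoc-* (q ℕ.* p) 1# x ⟨
      (q ℕ.* p) ⋆ 1# * x     ≈⟨ *-congʳ (×1-homo-* q p) ⟩
      q ⋆ 1# * p ⋆ 1# * x    ≈⟨ *-congʳ (*-congˡ p≈0) ⟩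
      q ⋆ 1# * 0# * x        ≈⟨ *-congʳ (zeroʳ _) ⟩
      0# * x                 ≈⟨ zeroˡ x ⟩
      0#                     ∎

    ^p-distrib-+ : ∀ x y → (x + y) ^ p ≈ x ^ p + y ^ p
    ^p-distrib-+ x y = helper p-prime ≡.refl
      where
      -- `p` is a module parameter; a fresh `q` equal to it can be split into zero and successor, as
      -- the two end terms of the binomial sum require.
      helper : ∀ {q} → Prime q → q ≡ p → (x + y) ^ q ≈ x ^ q + y ^ q
      helper {zero} 0-prime _ = contradiction 0-prime ¬prime[0]
      helper {suc q} _ ≡.refl = begin
        (x + y) ^ suc q
          ≈⟨ binomial-theorem (suc q) x y ⟩
        term zero + sum (λ i → term (suc i))
          ≈⟨ +-congˡ (sum-init-last (λ i → term (suc i))) ⟩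
        term zero + (sum (λ i → term (suc (inject₁ i))) + term (suc (fromℕ q)))
          ≈⟨ +-cong bottom (+-cong (trans (sum-cong-≋ middle) (sum-replicate-zero q)) top) ⟩
        y ^ suc q + (0# + x ^ suc q)
          ≈⟨ +-congˡ (+-identityˡ _) ⟩
        y ^ suc q + x ^ suc q
          ≈⟨ +-comm _ _ ⟩
        x ^ suc q + y ^ suc q ∎
        where
        term : Fin (suc (suc q)) → Carrier
        term i = (suc q C toℕ i) ⋆ (x ^ toℕ i * y ^ (suc q ℕ.∸ toℕ i))

        bottom : term zero ≈ y ^ suc q
        bottom = trans (×-homo-1 _) (*-identityˡ _)

        middle : ∀ i → term (suc (inject₁ i)) ≈ 0#
        middle i = p∣⇒⋆≈0 _ (prime∣C p-prime (suc (toℕ (inject₁ i))) (ℕ.s≤s ℕ.z≤n)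
          (ℕ.s≤s (≡.subst (ℕ._< q) (≡.sym (Fin.toℕ-inject₁ i)) (Fin.toℕ<n i))))

        top : term (suc (fromℕ q)) ≈ x ^ suc q
        top rewrite Fin.toℕ-fromℕ q | nCn≡1 (suc q) | ℕ.n∸n≡0 q =
          trans (×-homo-1 _) (*-identityʳ _)

    ^p^-distrib-+ : ∀ m x y → (x + y) ^ (p ℕ.^ m) ≈ x ^ (p ℕ.^ m) + y ^ (p ℕ.^ m)
    ^p^-distrib-+ zero x y = trans (*-identityʳ _) (sym (+-cong (*-identityʳ x) (*-identityʳ y)))
    ^p^-distrib-+ (suc m) x y = begin
      (x + y) ^ (p ℕ.* p ℕ.^ m)
        ≈⟨ ^-assocʳ _ p _ ⟨
      ((x + y) ^ p) ^ (p ℕ.^ m)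
        ≈⟨ ^-congˡ (p ℕ.^ m) (^p-distrib-+ x y) ⟩
      (x ^ p + y ^ p) ^ (p ℕ.^ m)
        ≈⟨ ^p^-distrib-+ m (x ^ p) (y ^ p) ⟩
      (x ^ p) ^ (p ℕ.^ m) + (y ^ p) ^ (p ℕ.^ m)
        ≈⟨ +-cong (^-assocʳ x p _) (^-assocʳ y p _) ⟩
      x ^ (p ℕ.* p ℕ.^ m) + y ^ (p ℕ.* p ℕ.^ m) ∎

  -- Monic polynomials and their roots.

  -- Monic polynomials, represented by their lower coefficients.
  eval : ∀ {D} → Vec Carrier D → Carrier → Carrier
  eval []       x = 1#
  eval (a ∷ as) x = a + x * eval as x

  -- Synthetic division by x - a: the coefficients of the quotient are the intermediate Horner
  -- values at `a`. The quotient is again monic, so its leading 1 stays implicit.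
  quotient : ∀ {D} → Carrier → Vec Carrier (suc D) → Vec Carrier D
  quotient a (_ ∷ [])     = []
  quotient a (_ ∷ b ∷ bs) = eval (b ∷ bs) a ∷ quotient a (b ∷ bs)

  eval-quotient : ∀ {D} a (as : Vec Carrier (suc D)) x →
    eval as x ≈ eval as a + (x - a) * eval (quotient a as) x
  eval-quotient a (b ∷ []) x =
    solve 4 (λ a b x e → b :+ x :* e := b :+ a :* e :+ (x :- a) :* e) refl a b x 1#
    where open RingSolver R
  eval-quotient a (b ∷ b′ ∷ bs) x = begin
    b + x * eval (b′ ∷ bs) x
      ≈⟨ +-congˡ (*-congˡ (eval-quotient a (b′ ∷ bs) x)) ⟩
    b + x * (eval (b′ ∷ bs) a + (x - a) * eval (quotient a (b′ ∷ bs)) x)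
      ≈⟨ solve 5 (λ a b x e q → b :+ x :* (e :+ (x :- a) :* q)
           := b :+ a :* e :+ (x :- a) :* (e :+ x :* q)) refl a b x _ _ ⟩
    b + a * eval (b′ ∷ bs) a + (x - a) * (eval (b′ ∷ bs) a + x * eval (quotient a (b′ ∷ bs)) x) ∎
    where open RingSolver R

  eval-x^-1 : ∀ D x → eval (- 1# ∷ replicate D 0#) x ≈ x ^ suc D - 1#
  eval-x^-1 D x = trans (+-comm _ _) (+-congʳ (*-congˡ (eval-x^ D)))
    where
    eval-x^ : ∀ D → eval (replicate D 0#) x ≈ x ^ D
    eval-x^ zero    = refl
    eval-x^ (suc D) = trans (+-identityˡ _) (*-congˡ (eval-x^ D))

-- Finite fields: Fermat, characteristic, root counting.

module FiniteFieldTheory {c ℓ : Level} (F : CommutativeRing c ℓ) {N : ℕ}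
  (isFiniteField : IsFiniteFieldOfOrder F (suc N)) where
  open CommutativeRing F hiding (zero)
  open IsFiniteFieldOfOrder isFiniteField
  open CommutativeRingTheory F
  open import Algebra.Properties.Ring ring using (x∙y⁻¹≈ε⇒x≈y; x≈y⇒x∙y⁻¹≈ε)
  open import Algebra.Properties.Semiring.Mult semiring using (×1-homo-*) renaming (_×_ to _⋆_)
  open import Algebra.Properties.CommutativeMonoid.Sum *-commutativeMonoid
    using () renaming (sum to product)
  open import Algebra.Properties.CommutativeMonoid.Sum +-commutativeMonoid using (sum)
  open import Relation.Binary.Reasoning.Setoid setoid

  index : Carrier → Fin (suc N)
  index x = proj₁ (enum-sur x)

  enum-index : ∀ x → enum (index x) ≈ x
  enum-index x = proj₂ (enum-sur x)

  _≟_ : ∀ x y → Dec (x ≈ y)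
  x ≟ y with index x Fin.≟ index y
  ... | yes eq = yes (trans (sym (enum-index x)) (trans (reflexive (≡.cong enum eq)) (enum-index y)))
  ... | no neq = no λ x≈y → neq (enum-inj _ _ (trans (enum-index x) (trans x≈y (sym (enum-index y)))))

  *-cancelˡ : ∀ {a x y} → a ≉ 0# → a * x ≈ a * y → x ≈ y
  *-cancelˡ {a} {x} {y} a≉0 ax≈ay with b , ab≈1 ← inverse a a≉0 = trans (sym (undo x)) (trans (*-congˡ ax≈ay) (undo y))
    where
    undo : ∀ z → b * (a * z) ≈ z
    undo z = trans (sym (*-assoc b a z))
      (trans (*-congʳ (trans (*-comm b a) ab≈1)) (*-identityˡ z))

  *-cancelʳ : ∀ {a x y} → a ≉ 0# → x * a ≈ y * a → x ≈ y
  *-cancelʳ a≉0 xa≈ya = *-cancelˡ a≉0 (trans (*-comm _ _) (trans xa≈ya (*-comm _ _)))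

  divide : ∀ x {y} → y ≉ 0# → ∃ λ z → x ≈ z * y
  divide x {y} y≉0 with y⁻¹ , yy⁻¹≈1 ← inverse y y≉0 = x * y⁻¹ , sym (begin
    x * y⁻¹ * y    ≈⟨ *-assoc x y⁻¹ y ⟩
    x * (y⁻¹ * y)  ≈⟨ *-congˡ (trans (*-comm y⁻¹ y) yy⁻¹≈1) ⟩
    x * 1#         ≈⟨ *-identityʳ x ⟩
    x              ∎)

  *≈0⇒≈0ʳ : ∀ {x y} → x ≉ 0# → x * y ≈ 0# → y ≈ 0#
  *≈0⇒≈0ʳ x≉0 xy≈0 = *-cancelˡ x≉0 (trans xy≈0 (sym (zeroʳ _)))

  *-≉0 : ∀ {x y} → x ≉ 0# → y ≉ 0# → x * y ≉ 0#
  *-≉0 x≉0 y≉0 xy≈0 = y≉0 (*≈0⇒≈0ʳ x≉0 xy≈0)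

  ^-≉0 : ∀ {x} n → x ≉ 0# → x ^ n ≉ 0#
  ^-≉0 zero    x≉0 = 1≉0
  ^-≉0 (suc n) x≉0 = *-≉0 x≉0 (^-≉0 n x≉0)

  ^≈0⇒≈0 : ∀ {x} n → x ^ n ≈ 0# → x ≈ 0#
  ^≈0⇒≈0 {x} n x^n≈0 with x ≟ 0#
  ... | yes x≈0 = x≈0
  ... | no x≉0  = contradiction x^n≈0 (^-≉0 n x≉0)

  product-≉0 : ∀ {n} (e : Fin n → Carrier) → (∀ i → e i ≉ 0#) → product e ≉ 0#
  product-≉0 {zero}  e e≉0 = 1≉0
  product-≉0 {suc n} e e≉0 = *-≉0 (e≉0 zero) (product-≉0 (λ i → e (suc i)) (λ i → e≉0 (suc i)))

  unit : Fin N → Carrier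
  unit j = enum (punchIn (index 0#) j)

  unit-≉0 : ∀ j → unit j ≉ 0#
  unit-≉0 j uj≈0 = Fin.punchInᵢ≢i (index 0#) j (enum-inj _ _ (trans uj≈0 (sym (enum-index 0#))))

  unit-inj : ∀ i j → unit i ≈ unit j → i ≡ j
  unit-inj i j eq = Fin.punchIn-injective (index 0#) i j (enum-inj _ _ eq)

  unit-sur : ∀ x → x ≉ 0# → ∃ λ j → unit j ≈ x
  unit-sur x x≉0 = punchOut i₀≢i ,
    trans (reflexive (≡.cong enum (Fin.punchIn-punchOut i₀≢i))) (enum-index x)
    where
    i₀≢i : index 0# ≢ index x
    i₀≢i eq = x≉0 (trans (sym (enum-index x)) (trans (reflexive (≡.cong enum (≡.sym eq))) (enum-index 0#)))

  -- Adding 1 permutes the field, so the sum of all elements is unchanged by `suc N` extra ones.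
  order⋆1≈0 : suc N ⋆ 1# ≈ 0#
  order⋆1≈0 = +-cancelʳ (sum enum) _ _ (trans (sym
    (translate-sum +-commutativeMonoid enum enum-inj 1# (- 1#) (-‿inverseʳ 1#)
      (λ j → enum-sur _) (λ j → enum-sur _))) (sym (+-identityˡ _)))
    where open import Algebra.Properties.Group +-group using () renaming (∙-cancelʳ to +-cancelʳ)

  -- The multiplicative analogue: multiplication by `x` permutes the units, and their product is
  -- nonzero and cancels.
  ≉0⇒^N≈1 : ∀ {x} → x ≉ 0# → x ^ N ≈ 1#
  ≉0⇒^N≈1 {x} x≉0 with y , xy≈1 ← inverse x x≉0 = *-cancelʳ (product-≉0 unit unit-≉0) (trans (sym
    (translate-sum *-commutativeMonoid unit unit-inj x y xy≈1
      (λ j → unit-sur _ (*-≉0 x≉0 (unit-≉0 j))) (λ j → unit-sur _ (*-≉0 y≉0 (unit-≉0 j)))))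
      (sym (*-identityˡ _)))
    where
    y≉0 : y ≉ 0#
    y≉0 y≈0 = 1≉0 (trans (sym xy≈1) (trans (*-congˡ y≈0) (zeroʳ x)))

  ^order≈id : ∀ x → x ^ suc N ≈ x
  ^order≈id x with x ≟ 0#
  ... | yes x≈0 = trans (*-congʳ x≈0) (trans (zeroˡ _) (sym x≈0))
  ... | no x≉0  = trans (*-congˡ (≉0⇒^N≈1 x≉0)) (*-identityʳ x)

  -- The order of the field annihilates 1, and p^k copies of 1 are the k-th power of p copies; a
  -- field has no nilpotents.
  characteristic : ∀ p k → suc N ≡ p ℕ.^ k → p ⋆ 1# ≈ 0#
  characteristic p k order≡p^k = ^≈0⇒≈0 k (begin
    (p ⋆ 1#) ^ k    ≈⟨ ^⋆1 k ⟨
    (p ℕ.^ k) ⋆ 1#  ≡⟨ ≡.cong (_⋆ 1#) order≡p^k ⟨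
    suc N ⋆ 1#      ≈⟨ order⋆1≈0 ⟩
    0#              ∎)
    where
    ^⋆1 : ∀ k → (p ℕ.^ k) ⋆ 1# ≈ (p ⋆ 1#) ^ k
    ^⋆1 zero    = +-identityʳ 1#
    ^⋆1 (suc k) = trans (×1-homo-* p (p ℕ.^ k)) (*-congˡ (^⋆1 k))

  injective⇒permutes : ∀ (g : Carrier → Carrier) → (∀ {x y} → x ≈ y → g x ≈ g y) →
    (∀ x y → g x ≈ g y → x ≈ y) → Permutes F g
  injective⇒permutes g g-cong g-inj = g-inj , λ y →
    let i , gi≡y = injective⇒surjective (λ i → index (g (enum i))) inj (index y)
    in enum i , trans (sym (enum-index _)) (trans (reflexive (≡.cong enum gi≡y)) (enum-index y))
    where
    inj : ∀ i j → index (g (enum i)) ≡ index (g (enum j)) → i ≡ j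
    inj i j eq = enum-inj i j (g-inj _ _
      (trans (sym (enum-index _)) (trans (reflexive (≡.cong enum eq)) (enum-index _))))

  -- Dividing by x - r₀ leaves the other points as roots, since their differences from r₀ are
  -- invertible; at degree 0 the constant 1 remains.
  more-roots-than-degree : ∀ {D} (as : Vec Carrier D) (r : Fin (suc D) → Carrier) →
    (∀ i j → r i ≈ r j → i ≡ j) → ¬ (∀ i → eval as (r i) ≈ 0#)
  more-roots-than-degree [] r r-inj roots = 1≉0 (roots zero)
  more-roots-than-degree as@(_ ∷ _) r r-inj roots =
    more-roots-than-degree (quotient (r zero) as) (λ i → r (suc i))
      (λ i j eq → Fin.suc-injective (r-inj _ _ eq))
      (λ i → *≈0⇒≈0ʳ (difference≉0 i) (begin
        (r (suc i) - r zero) * eval (quotient (r zero) as) (r (suc i))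
          ≈⟨ +-identityˡ _ ⟨
        0# + (r (suc i) - r zero) * eval (quotient (r zero) as) (r (suc i))
          ≈⟨ +-congʳ (roots zero) ⟨
        eval as (r zero) + (r (suc i) - r zero) * eval (quotient (r zero) as) (r (suc i))
          ≈⟨ eval-quotient (r zero) as (r (suc i)) ⟨
        eval as (r (suc i))
          ≈⟨ roots (suc i) ⟩
        0# ∎))
    where
    difference≉0 : ∀ i → r (suc i) - r zero ≉ 0#
    difference≉0 i eq with () ← r-inj _ _ (x∙y⁻¹≈ε⇒x≈y _ _ eq)

  exponent-bound : ∀ D → (∀ {x} → x ≉ 0# → x ^ suc D ≈ 1#) → N ℕ.≤ suc D
  -- If `suc D` were below `N`, there would be `suc (suc D)` distinct units, all of them roots of
  -- x^(D+1) - 1.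
  exponent-bound D x^D≈1 = ℕ.≮⇒≥ λ D<N → more-roots-than-degree (- 1# ∷ replicate D 0#)
    (λ i → unit (inject≤ i D<N))
    (λ i j eq → Fin.inject≤-injective D<N D<N i j (unit-inj _ _ eq))
    (λ i → trans (eval-x^-1 D _) (x≈y⇒x∙y⁻¹≈ε (x^D≈1 (unit-≉0 _))))

-- The field of order Q^2 and the gcd criterion for roots of 1.

module QuadraticExtension {c ℓ : Level} (F : CommutativeRing c ℓ) {q : ℕ}
  (isFiniteField : IsFiniteFieldOfOrder F (suc (suc q) ℕ.* suc (suc q))) where
  open CommutativeRing F hiding (zero)
  open CommutativeRingTheory F
  open FiniteFieldTheory F isFiniteField
  open import Relation.Binary.Reasoning.Setoid setoid

  M Q : ℕ
  M = suc q
  Q = suc M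

  -- With M = (e+1)d and d = gcd(m, M), the element x^((Q+1)(e+1)) has d-th power (x^M)^(Q+1) = 1,
  -- so its m-th and M-th powers are 1. By hypothesis it is itself 1 for every unit x, and
  -- `exponent-bound` gives (Q+1)M ≤ (Q+1)(e+1), that is d ≤ 1.
  trivial-roots⇒coprime : ∀ m → (∀ {t} → t ^ M ≈ 1# → t ^ m ≈ 1# → t ≈ 1#) → gcd m M ≡ 1
  trivial-roots⇒coprime m trivial with gcd[m,n]∣n m M | gcd[m,n]∣m m M
  ... | divides zero () | _
  ... | divides (suc e) M≡ed | divides f m≡fd = ℕ.≤-antisym d≤1 1≤d
    where
    d = gcd m M

    x^D≈1 : ∀ {x} → x ≉ 0# → x ^ (suc Q ℕ.* suc e) ≈ 1#
    x^D≈1 {x} x≉0 = trivial (begin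
      (x ^ (suc Q ℕ.* suc e)) ^ M  ≈⟨ ^-comm x (suc Q ℕ.* suc e) M ⟩
      (x ^ M) ^ (suc Q ℕ.* suc e)  ≈⟨ ^-assocʳ (x ^ M) (suc Q) (suc e) ⟨
      ((x ^ M) ^ suc Q) ^ suc e    ≈⟨ ^-congˡ (suc e) x^M^1+Q≈1 ⟩
      1# ^ suc e                   ≈⟨ 1^ (suc e) ⟩
      1#                           ∎) (begin
      (x ^ (suc Q ℕ.* suc e)) ^ m            ≈⟨ ^-congʳ _ (≡.trans m≡fd (ℕ.*-comm f d)) ⟩
      (x ^ (suc Q ℕ.* suc e)) ^ (d ℕ.* f)    ≈⟨ ^-assocʳ _ d f ⟨
      ((x ^ (suc Q ℕ.* suc e)) ^ d) ^ f      ≈⟨ ^-congˡ f (^-congˡ d (^-assocʳ x (suc Q) (suc e))) ⟨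
      (((x ^ suc Q) ^ suc e) ^ d) ^ f        ≈⟨ ^-congˡ f (^-assocʳ (x ^ suc Q) (suc e) d) ⟩
      ((x ^ suc Q) ^ (suc e ℕ.* d)) ^ f      ≈⟨ ^-congˡ f (^-congʳ _ M≡ed) ⟨
      ((x ^ suc Q) ^ M) ^ f                  ≈⟨ ^-congˡ f (trans (^-comm x (suc Q) M) x^M^1+Q≈1) ⟩
      1# ^ f                                 ≈⟨ 1^ f ⟩
      1#                                     ∎)
      where
      x^M^1+Q≈1 : (x ^ M) ^ suc Q ≈ 1#
      x^M^1+Q≈1 = begin
        (x ^ M) ^ suc Q       ≈⟨ ^-assocʳ x M (suc Q) ⟩
        x ^ (M ℕ.* suc Q)     ≈⟨ ^-congʳ x (ℕ.*-suc M Q) ⟩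
        -- `Q * Q` computes to `suc (M + M * Q)`, so this exponent is literally the number of units.
        x ^ (M ℕ.+ M ℕ.* Q)   ≈⟨ ≉0⇒^N≈1 x≉0 ⟩
        1#                    ∎

    M≤e : M ℕ.≤ suc e
    M≤e = ℕ.*-cancelˡ-≤ (suc Q) (≡.subst (ℕ._≤ suc Q ℕ.* suc e)
      (≡.trans (≡.sym (ℕ.*-suc M Q)) (ℕ.*-comm M (suc Q)))
      (exponent-bound _ x^D≈1))

    d≤1 : d ℕ.≤ 1
    d≤1 = ℕ.*-cancelˡ-≤ (suc e) (≡.subst₂ ℕ._≤_ M≡ed (≡.sym (ℕ.*-identityʳ (suc e))) M≤e)

    1≤d : 1 ℕ.≤ d
    1≤d = ℕ.n≢0⇒n>0 λ d≡0 → contradiction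
      (≡.trans M≡ed (≡.trans (≡.cong (suc e ℕ.*_) d≡0) (ℕ.*-zeroʳ (suc e)))) λ ()

  coprime⇒trivial : ∀ m → gcd m M ≡ 1 → ∀ {t} → t ^ M ≈ 1# → t ^ m ≈ 1# → t ≈ 1#
  coprime⇒trivial m gcd≡1 {t} t^M≈1 t^m≈1 = begin
    t            ≈⟨ *-identityʳ t ⟨
    t ^ 1        ≈⟨ ^-congʳ t gcd≡1 ⟨
    t ^ gcd m M  ≈⟨ ^gcd≈1 m M t^m≈1 t^M≈1 ⟩
    1#           ∎

  -- The conjugation φ, its fixed field and its eigenvectors.

  module Conjugation (^Q-distrib-+ : ∀ x y → (x + y) ^ Q ≈ x ^ Q + y ^ Q) where
    open import Algebra.Properties.Group +-group
      renaming (∙-cancelˡ to +-cancelˡ) using (inverseˡ-unique; x∙y⁻¹≈ε⇒x≈y; x≈y⇒x∙y⁻¹≈ε)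
    open RingSolver F
    open IsFiniteFieldOfOrder isFiniteField using (1≉0)

    φ : Carrier → Carrier
    φ x = x ^ Q

    φ-cong : ∀ {x y} → x ≈ y → φ x ≈ φ y
    φ-cong = ^-congˡ Q

    φ-* : ∀ x y → φ (x * y) ≈ φ x * φ y
    φ-* x y = ^-distrib-* x y Q

    φ-^ : ∀ x n → φ (x ^ n) ≈ φ x ^ n
    φ-^ x n = ^-comm x n Q

    φ-involutive : ∀ x → φ (φ x) ≈ x
    φ-involutive x = trans (^-assocʳ x Q Q) (^order≈id x)

    φ-neg : ∀ x → φ (- x) ≈ - φ x
    φ-neg x = inverseˡ-unique _ _ (begin
      φ (- x) + φ x  ≈⟨ ^Q-distrib-+ (- x) x ⟨
      φ (- x + x)    ≈⟨ φ-cong (-‿inverseˡ x) ⟩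
      φ 0#           ≈⟨ zeroˡ _ ⟩
      0#             ∎)

    φ-- : ∀ x y → φ (x - y) ≈ φ x - φ y
    φ-- x y = trans (^Q-distrib-+ x (- y)) (+-congˡ (φ-neg y))

    fixed⇒^M≈1 : ∀ {t} → t ≉ 0# → φ t ≈ t → t ^ M ≈ 1#
    fixed⇒^M≈1 t≉0 φt≈t = *-cancelˡ t≉0 (trans φt≈t (sym (*-identityʳ _)))

    ^M≈1⇒fixed : ∀ {t} → t ^ M ≈ 1# → φ t ≈ t
    ^M≈1⇒fixed t^M≈1 = trans (*-congˡ t^M≈1) (*-identityʳ _)

    norm : Carrier → Carrier
    norm x = φ x * x

    φ-norm : ∀ x → φ (norm x) ≈ norm x
    φ-norm x = trans (φ-* (φ x) x) (trans (*-congʳ (φ-involutive x)) (*-comm _ _))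

    norm-≉0 : ∀ {x} → x ≉ 0# → norm x ≉ 0#
    norm-≉0 x≉0 = *-≉0 (^-≉0 Q x≉0) x≉0

    -- The quotient z / w is fixed by φ, so it is an M-th root of unity.
    eigen-root-unique : ∀ n → gcd (suc n) M ≡ 1 → ∀ {κ z w} → φ z ≈ κ * z → φ w ≈ κ * w →
      z ^ suc n ≈ w ^ suc n → z ≈ w
    eigen-root-unique n gcd≡1 {κ} {z} {w} φz≈κz φw≈κw z^n≈w^n with w ≟ 0#
    ... | yes w≈0 = trans (^≈0⇒≈0 (suc n) (trans z^n≈w^n (trans (*-congʳ w≈0) (zeroˡ _)))) (sym w≈0)
    ... | no w≉0 with t , z≈tw ← divide z w≉0 = begin
      z        ≈⟨ z≈tw ⟩
      t * w    ≈⟨ *-congʳ t≈1 ⟩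
      1# * w   ≈⟨ *-identityˡ w ⟩
      w        ∎
      where
      t^n≈1 : t ^ suc n ≈ 1#
      t^n≈1 = *-cancelʳ (^-≉0 (suc n) w≉0) (begin
        t ^ suc n * w ^ suc n  ≈⟨ ^-distrib-* t w (suc n) ⟨
        (t * w) ^ suc n        ≈⟨ ^-congˡ (suc n) z≈tw ⟨
        z ^ suc n              ≈⟨ z^n≈w^n ⟩
        w ^ suc n              ≈⟨ *-identityˡ _ ⟨
        1# * w ^ suc n         ∎)

      t≉0 : t ≉ 0#
      t≉0 t≈0 = 1≉0 (trans (sym t^n≈1) (trans (*-congʳ t≈0) (zeroˡ _)))

      φt≈t : φ t ≈ t
      φt≈t = *-cancelʳ (^-≉0 Q w≉0) (begin
        φ t * φ w     ≈⟨ φ-* t w ⟨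
        φ (t * w)     ≈⟨ φ-cong z≈tw ⟨
        φ z           ≈⟨ φz≈κz ⟩
        κ * z         ≈⟨ *-congˡ z≈tw ⟩
        κ * (t * w)   ≈⟨ solve 3 (λ a b c → a :* (b :* c) := b :* (a :* c)) refl κ t w ⟩
        t * (κ * w)   ≈⟨ *-congˡ φw≈κw ⟨
        t * φ w       ∎)

      t≈1 : t ≈ 1#
      t≈1 = coprime⇒trivial (suc n) gcd≡1 (fixed⇒^M≈1 t≉0 φt≈t) t^n≈1

    -- The ratio of two units of F_Q is an M-th root of 1, hence an m-th power in F_Q when m is
    -- coprime to M. This will equalise the norm factors of two points.
    fixed-ratio-root : ∀ m → gcd m M ≡ 1 → ∀ {a b} → φ a ≈ a → φ b ≈ b → a ≉ 0# → b ≉ 0# →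
      ∃ λ s → s ^ M ≈ 1# × s ^ m * b ≈ a
    fixed-ratio-root m gcd≡1 {a} {b} φa≈a φb≈b a≉0 b≉0
      with r , a≈rb ← divide a b≉0
      with s , s^M≈1 , s^m≈r ← coprime⇒root m q {r} gcd≡1 (fixed⇒^M≈1
        (λ r≈0 → a≉0 (trans a≈rb (trans (*-congʳ r≈0) (zeroˡ b))))
        (*-cancelʳ b≉0 (begin
          φ r * b    ≈⟨ *-congˡ φb≈b ⟨
          φ r * φ b  ≈⟨ φ-* r b ⟨
          φ (r * b)  ≈⟨ φ-cong a≈rb ⟨
          φ a        ≈⟨ φa≈a ⟩
          a          ≈⟨ a≈rb ⟩
          r * b      ∎)))
      = s , s^M≈1 , trans (*-congʳ s^m≈r) (sym a≈rb)

    -- The polynomial in the coordinates u and v; its parameter n is `suc n` here.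

    module Polynomial (n k : ℕ) (β δ : Carrier)
      (ββ^Q≈1 : φ β * β ≈ 1#) (δ∉fixed : φ δ ≉ δ) where

      u v f : Carrier → Carrier
      u x = φ x - β * x
      v x = δ * φ x - β * φ δ * x
      f x = norm x ^ k * (v x ^ suc n - δ * u x ^ suc n)

      -- x^n is absorbed into the two n-th powers, where `x * x ^ M` is `φ x`; the rest, x^(k(Q+1)),
      -- is the k-th power of the norm. Nothing is divided by x, so x = 0 is covered.
      fPoly≈f : ∀ x → fPoly F Q (suc n) k β δ x ≈ f x
      fPoly≈f x rewrite pow≡^ x (suc n ℕ.+ k ℕ.* (Q ℕ.+ 1)) | pow≡^ x M | pow≡^ δ Q
        | pow≡^ (δ * x ^ M - β * φ δ) (suc n) | pow≡^ (x ^ M - β) (suc n) = begin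
        x ^ (suc n ℕ.+ k ℕ.* (Q ℕ.+ 1)) * (a ^ suc n - δ * b ^ suc n)
          ≈⟨ *-congʳ (trans (^-homo-* x (suc n) _) (*-congˡ norm^k)) ⟩
        x ^ suc n * norm x ^ k * (a ^ suc n - δ * b ^ suc n)
          ≈⟨ solve 5 (λ y m d a b → y :* m :* (a :- d :* b) := m :* (a :* y :- d :* (b :* y)))
               refl _ _ _ _ _ ⟩
        norm x ^ k * (a ^ suc n * x ^ suc n - δ * (b ^ suc n * x ^ suc n))
          ≈⟨ *-congˡ (+-cong (collect ax≈v) (-‿cong (*-congˡ (collect bx≈u)))) ⟩
        f x ∎
        where
        a = δ * x ^ M - β * φ δ
        b = x ^ M - β

        norm^k : x ^ (k ℕ.* (Q ℕ.+ 1)) ≈ norm x ^ k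
        norm^k = begin
          x ^ (k ℕ.* (Q ℕ.+ 1))  ≈⟨ ^-congʳ x (ℕ.*-comm k (Q ℕ.+ 1)) ⟩
          x ^ ((Q ℕ.+ 1) ℕ.* k)  ≈⟨ ^-assocʳ x (Q ℕ.+ 1) k ⟨
          (x ^ (Q ℕ.+ 1)) ^ k    ≈⟨ ^-congˡ k (^-homo-* x Q 1) ⟩
          (φ x * (x * 1#)) ^ k   ≈⟨ ^-congˡ k (*-congˡ (*-identityʳ x)) ⟩
          norm x ^ k             ∎

        collect : ∀ {c y} → c * x ≈ y → c ^ suc n * x ^ suc n ≈ y ^ suc n
        collect {c} cx≈y = trans (sym (^-distrib-* c x (suc n))) (^-congˡ (suc n) cx≈y)

        ax≈v : a * x ≈ v x
        ax≈v = solve 5 (λ d y b e x → (d :* y :- b :* e) :* x := d :* (x :* y) :- b :* e :* x)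
          refl δ (x ^ M) β (φ δ) x

        bx≈u : b * x ≈ u x
        bx≈u = solve 3 (λ y b x → (y :- b) :* x := x :* y :- b :* x) refl (x ^ M) β x

      u-cong : ∀ {x y} → x ≈ y → u x ≈ u y
      u-cong x≈y = +-cong (φ-cong x≈y) (-‿cong (*-congˡ x≈y))

      v-cong : ∀ {x y} → x ≈ y → v x ≈ v y
      v-cong x≈y = +-cong (*-congˡ (φ-cong x≈y)) (-‿cong (*-congˡ x≈y))

      f-cong : ∀ {x y} → x ≈ y → f x ≈ f y
      f-cong x≈y = *-cong (^-congˡ k (*-cong (φ-cong x≈y) x≈y))
        (+-cong (^-congˡ (suc n) (v-cong x≈y)) (-‿cong (*-congˡ (^-congˡ (suc n) (u-cong x≈y)))))

      β≉0 : β ≉ 0#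
      β≉0 β≈0 = 1≉0 (trans (sym ββ^Q≈1) (trans (*-congˡ β≈0) (zeroʳ _)))

      κ : Carrier
      κ = - φ β

      κ≉0 : κ ≉ 0#
      κ≉0 κ≈0 = 1≉0 (begin
        1#         ≈⟨ ββ^Q≈1 ⟨
        φ β * β    ≈⟨ solve 2 (λ a b → a :* b := :- (:- a :* b)) refl (φ β) β ⟩
        - (κ * β)  ≈⟨ -‿cong (trans (*-congʳ κ≈0) (zeroˡ β)) ⟩
        - 0#       ≈⟨ trans (sym (+-identityˡ _)) (-‿inverseʳ 0#) ⟩
        0#         ∎)

      -- Inserts 1 as `φ β * β`, so that a term free of β shares a factor with its neighbour.
      κβ-expand : ∀ y → y ≈ φ β * β * y
      κβ-expand y = sym (trans (*-congʳ ββ^Q≈1) (*-identityˡ y))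

      φ-u : ∀ x → φ (u x) ≈ κ * u x
      φ-u x = begin
        φ (φ x - β * x)            ≈⟨ φ-- (φ x) (β * x) ⟩
        φ (φ x) - φ (β * x)        ≈⟨ +-cong (trans (φ-involutive x) (κβ-expand x)) (-‿cong (φ-* β x)) ⟩
        φ β * β * x - φ β * φ x    ≈⟨ solve 4 (λ c b x y → c :* b :* x :- c :* y := :- c :* (y :- b :* x))
                                        refl (φ β) β x (φ x) ⟩
        κ * u x                    ∎

      φ-v : ∀ x → φ (v x) ≈ κ * v x
      φ-v x = begin
        φ (δ * φ x - β * φ δ * x)
          ≈⟨ φ-- (δ * φ x) (β * φ δ * x) ⟩
        φ (δ * φ x) - φ (β * φ δ * x)
          ≈⟨ +-cong (trans (φ-* δ (φ x)) (*-congˡ (trans (φ-involutive x) (κβ-expand x))))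
               (-‿cong (trans (φ-* (β * φ δ) x) (*-congʳ (trans (φ-* β (φ δ)) (*-congˡ (φ-involutive δ)))))) ⟩
        φ δ * (φ β * β * x) - φ β * δ * φ x
          ≈⟨ solve 6 (λ d e c b x y → e :* (c :* b :* x) :- c :* d :* y := :- c :* (d :* y :- b :* e :* x))
               refl δ (φ δ) (φ β) β x (φ x) ⟩
        κ * v x ∎

      -- Eliminating `φ x` inverts the coordinate map; the coefficient of `x` is nonzero because δ
      -- is not fixed by φ.
      recover : ∀ x → v x - δ * u x ≈ β * (δ - φ δ) * x
      recover x = solve 5 (λ d e b x y → (d :* y :- b :* e :* x) :- d :* (y :- b :* x)
        := b :* (d :- e) :* x) refl δ (φ δ) β x (φ x)

      β[δ-φδ]≉0 : β * (δ - φ δ) ≉ 0#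
      β[δ-φδ]≉0 = *-≉0 β≉0 λ eq → δ∉fixed (sym (x∙y⁻¹≈ε⇒x≈y _ _ eq))

      u,v≈0⇒≈0 : ∀ {x} → u x ≈ 0# → v x ≈ 0# → x ≈ 0#
      u,v≈0⇒≈0 {x} u≈0 v≈0 = *≈0⇒≈0ʳ β[δ-φδ]≉0 (begin
        β * (δ - φ δ) * x  ≈⟨ recover x ⟨
        v x - δ * u x      ≈⟨ x≈y⇒x∙y⁻¹≈ε (trans v≈0 (sym (trans (*-congˡ u≈0) (zeroʳ δ)))) ⟩
        0#                 ∎)

      -- 1 and δ are independent over the fixed field of φ, hence over each eigenspace.
      independent : ∀ {κ a b} → κ ≉ 0# → φ a ≈ κ * a → φ b ≈ κ * b → a ≈ δ * b → b ≈ 0#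
      independent {κ} {a} {b} κ≉0 φa φb a≈δb with b ≟ 0#
      ... | yes b≈0 = b≈0
      ... | no b≉0 = contradiction (*-cancelʳ (*-≉0 κ≉0 b≉0) (begin
        φ δ * (κ * b)   ≈⟨ *-congˡ φb ⟨
        φ δ * φ b       ≈⟨ φ-* δ b ⟨
        φ (δ * b)       ≈⟨ φ-cong a≈δb ⟨
        φ a             ≈⟨ φa ⟩
        κ * a           ≈⟨ *-congˡ a≈δb ⟩
        κ * (δ * b)     ≈⟨ solve 3 (λ a b c → a :* (b :* c) := b :* (a :* c)) refl κ δ b ⟩
        δ * (κ * b)     ∎)) δ∉fixed

      -- The norm is fixed by φ, so the eigenvalue does not depend on `x`: terms from different
      -- points lie in one eigenspace and can be subtracted.
      eigen-norm^k*^n : ∀ x {w} → φ w ≈ κ * w →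
        φ (norm x ^ k * w ^ suc n) ≈ κ ^ suc n * (norm x ^ k * w ^ suc n)
      eigen-norm^k*^n x {w} φw = begin
        φ (norm x ^ k * w ^ suc n)
          ≈⟨ φ-* _ _ ⟩
        φ (norm x ^ k) * φ (w ^ suc n)
          ≈⟨ *-cong (trans (φ-^ (norm x) k) (^-congˡ k (φ-norm x))) (trans (φ-^ w (suc n)) (^-congˡ (suc n) φw)) ⟩
        norm x ^ k * (κ * w) ^ suc n
          ≈⟨ *-congˡ (^-distrib-* κ w (suc n)) ⟩
        norm x ^ k * (κ ^ suc n * w ^ suc n)
          ≈⟨ solve 3 (λ a b c → a :* (b :* c) := b :* (a :* c)) refl _ _ _ ⟩
        κ ^ suc n * (norm x ^ k * w ^ suc n) ∎

      eigen-- : ∀ {κ a b} → φ a ≈ κ * a → φ b ≈ κ * b → φ (a - b) ≈ κ * (a - b)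
      eigen-- {κ} {a} {b} φa φb = trans (φ-- a b) (trans (+-cong φa (-‿cong φb))
        (solve 3 (λ k a b → k :* a :- k :* b := k :* (a :- b)) refl κ a b))

      -- The equation rearranges to a = δ b, with a and b the differences of the v-terms and of the
      -- u-terms; both are eigenvectors for `κ ^ suc n`, so `independent` applies.
      f-separates : ∀ x y → f x ≈ f y →
        norm x ^ k * u x ^ suc n ≈ norm y ^ k * u y ^ suc n ×
        norm x ^ k * v x ^ suc n ≈ norm y ^ k * v y ^ suc n
      f-separates x y fx≈fy = x∙y⁻¹≈ε⇒x≈y _ _ b≈0 ,
        x∙y⁻¹≈ε⇒x≈y _ _ (trans a≈δb (trans (*-congˡ b≈0) (zeroʳ δ)))
        where
        a = norm x ^ k * v x ^ suc n - norm y ^ k * v y ^ suc n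
        b = norm x ^ k * u x ^ suc n - norm y ^ k * u y ^ suc n

        a≈δb : a ≈ δ * b
        a≈δb = x∙y⁻¹≈ε⇒x≈y _ _ (begin
          a - δ * b  ≈⟨ solve 7 (λ m m′ v v′ u u′ d →
                          (m :* v :- m′ :* v′) :- d :* (m :* u :- m′ :* u′)
                          := m :* (v :- d :* u) :- m′ :* (v′ :- d :* u′)) refl _ _ _ _ _ _ _ ⟩
          f x - f y  ≈⟨ x≈y⇒x∙y⁻¹≈ε fx≈fy ⟩
          0#         ∎)

        b≈0 : b ≈ 0#
        b≈0 = independent (^-≉0 (suc n) κ≉0)
          (eigen-- (eigen-norm^k*^n x (φ-v x)) (eigen-norm^k*^n y (φ-v y)))
          (eigen-- (eigen-norm^k*^n x (φ-u x)) (eigen-norm^k*^n y (φ-u y))) a≈δb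

      -- Homogeneity over F_Q and the zero of f.

      module _ {t : Carrier} (t^M≈1 : t ^ M ≈ 1#) where

        u-homogeneous : ∀ x → u (t * x) ≈ t * u x
        u-homogeneous x = trans (+-congʳ (trans (φ-* t x) (*-congʳ (^M≈1⇒fixed t^M≈1))))
          (solve 4 (λ t x y b → t :* y :- b :* (t :* x) := t :* (y :- b :* x)) refl t x (φ x) β)

        v-homogeneous : ∀ x → v (t * x) ≈ t * v x
        v-homogeneous x = trans (+-congʳ (*-congˡ (trans (φ-* t x) (*-congʳ (^M≈1⇒fixed t^M≈1)))))
          (solve 5 (λ t x y c d → d :* (t :* y) :- c :* (t :* x) := t :* (d :* y :- c :* x))
            refl t x (φ x) (β * φ δ) δ)

        f-homogeneous : ∀ x → f (t * x) ≈ t ^ (suc n ℕ.+ 2 ℕ.* k) * f x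
        f-homogeneous x = begin
          norm (t * x) ^ k * (v (t * x) ^ suc n - δ * u (t * x) ^ suc n)
            ≈⟨ *-cong norm-part (+-cong (power-part (v-homogeneous x))
                 (-‿cong (*-congˡ (power-part (u-homogeneous x))))) ⟩
          t ^ (2 ℕ.* k) * norm x ^ k * (t ^ suc n * v x ^ suc n - δ * (t ^ suc n * u x ^ suc n))
            ≈⟨ solve 6 (λ s m p v u d → s :* m :* (p :* v :- d :* (p :* u)) := p :* s :* (m :* (v :- d :* u)))
                 refl _ _ _ _ _ _ ⟩
          t ^ suc n * t ^ (2 ℕ.* k) * f x
            ≈⟨ *-congʳ (^-homo-* t (suc n) (2 ℕ.* k)) ⟨
          t ^ (suc n ℕ.+ 2 ℕ.* k) * f x ∎
          where
          power-part : ∀ {y z} → y ≈ t * z → y ^ suc n ≈ t ^ suc n * z ^ suc n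
          power-part {y} {z} y≈tz = trans (^-congˡ (suc n) y≈tz) (^-distrib-* t z (suc n))

          norm-part : norm (t * x) ^ k ≈ t ^ (2 ℕ.* k) * norm x ^ k
          norm-part = begin
            (φ (t * x) * (t * x)) ^ k
              ≈⟨ ^-congˡ k (*-congʳ (trans (φ-* t x) (*-congʳ (^M≈1⇒fixed t^M≈1)))) ⟩
            (t * φ x * (t * x)) ^ k
              ≈⟨ ^-congˡ k (solve 3 (λ t x y → t :* y :* (t :* x) := t :* t :* (y :* x)) refl t x (φ x)) ⟩
            (t * t * norm x) ^ k
              ≈⟨ ^-distrib-* (t * t) (norm x) k ⟩
            (t * t) ^ k * norm x ^ k
              ≈⟨ *-congʳ (^-congˡ k (*-congˡ (*-identityʳ t))) ⟨
            (t ^ 2) ^ k * norm x ^ k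
              ≈⟨ *-congʳ (^-assocʳ t 2 k) ⟩
            t ^ (2 ℕ.* k) * norm x ^ k ∎

      u0≈0 : u 0# ≈ 0#
      u0≈0 = x≈y⇒x∙y⁻¹≈ε (trans (zeroˡ _) (sym (zeroʳ β)))

      v0≈0 : v 0# ≈ 0#
      v0≈0 = x≈y⇒x∙y⁻¹≈ε (trans (trans (*-congˡ (zeroˡ _)) (zeroʳ δ)) (sym (zeroʳ _)))

      f0≈0 : f 0# ≈ 0#
      f0≈0 = trans (*-congˡ (x≈y⇒x∙y⁻¹≈ε (trans (^0 v0≈0)
        (sym (trans (*-congˡ (^0 u0≈0)) (zeroʳ δ)))))) (zeroʳ _)
        where
        ^0 : ∀ {x} → x ≈ 0# → x ^ suc n ≈ 0#
        ^0 x≈0 = trans (*-congʳ x≈0) (zeroˡ _)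

      -- Separation of `x` from 0: as the norm of a nonzero `x` is nonzero, both coordinates would
      -- vanish.
      f≈0⇒≈0 : ∀ {x} → f x ≈ 0# → x ≈ 0#
      f≈0⇒≈0 {x} fx≈0 with x ≟ 0#
      ... | yes x≈0 = x≈0
      ... | no x≉0 = u,v≈0⇒≈0 (vanish u0≈0 (proj₁ separated)) (vanish v0≈0 (proj₂ separated))
        where
        separated = f-separates x 0# (trans fx≈0 (sym f0≈0))

        vanish : ∀ {a b m} → b ≈ 0# → norm x ^ k * a ^ suc n ≈ m * b ^ suc n → a ≈ 0#
        vanish {m = m} b≈0 eq = ^≈0⇒≈0 (suc n) (*≈0⇒≈0ʳ (^-≉0 k (norm-≉0 x≉0))
          (trans eq (trans (*-congˡ (trans (*-congʳ b≈0) (zeroˡ _))) (zeroʳ m))))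

      -- Coprimality implies injectivity.

      -- With x = t y, equality of the ratios u : v forces t into F_Q; homogeneity then makes t an
      -- e-th root of 1.
      coprime⇒injective : gcd (suc n ℕ.* (suc n ℕ.+ 2 ℕ.* k)) M ≡ 1 → ∀ x y → f x ≈ f y → x ≈ y
      coprime⇒injective gcd≡1 x y fx≈fy with x ≟ 0# | y ≟ 0#
      ... | yes x≈0 | _ = trans x≈0 (sym (f≈0⇒≈0 (trans (sym fx≈fy) (trans (f-cong x≈0) f0≈0))))
      ... | no _ | yes y≈0 = trans (f≈0⇒≈0 (trans fx≈fy (trans (f-cong y≈0) f0≈0))) (sym y≈0)
      ... | no x≉0 | no y≉0 with t , x≈ty ← divide x y≉0 = begin
        x       ≈⟨ x≈ty ⟩
        t * y   ≈⟨ *-congʳ t≈1 ⟩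
        1# * y  ≈⟨ *-identityˡ y ⟩
        y       ∎
        where
        e = suc n ℕ.+ 2 ℕ.* k

        n-coprime : gcd (suc n) M ≡ 1
        n-coprime = trivial-roots⇒coprime (suc n) λ {t} t^M≈1 t^n≈1 →
          coprime⇒trivial (suc n ℕ.* e) gcd≡1 t^M≈1
            (trans (^-congʳ t (ℕ.*-comm (suc n) e)) (^≈1⇒^*≈1 (suc n) e t^n≈1))

        separated = f-separates x y fx≈fy

        -- Ratios are compared as products because `u y` may vanish. Both products are eigenvectors
        -- for `κ * κ`, so their n-th powers determine them.
        vu′≈v′u : v x * u y ≈ v y * u x
        vu′≈v′u = eigen-root-unique n n-coprime (eigen-* (φ-v x) (φ-u y)) (eigen-* (φ-v y) (φ-u x))
          (*-cancelˡ (*-≉0 (^-≉0 k (norm-≉0 x≉0)) (^-≉0 k (norm-≉0 y≉0))) (begin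
            norm x ^ k * norm y ^ k * (v x * u y) ^ suc n
              ≈⟨ *-congˡ (^-distrib-* (v x) (u y) (suc n)) ⟩
            norm x ^ k * norm y ^ k * (v x ^ suc n * u y ^ suc n)
              ≈⟨ interchange _ _ _ _ ⟩
            norm x ^ k * v x ^ suc n * (norm y ^ k * u y ^ suc n)
              ≈⟨ *-cong (proj₂ separated) (sym (proj₁ separated)) ⟩
            norm y ^ k * v y ^ suc n * (norm x ^ k * u x ^ suc n)
              ≈⟨ interchange _ _ _ _ ⟨
            norm y ^ k * norm x ^ k * (v y ^ suc n * u x ^ suc n)
              ≈⟨ *-cong (*-comm _ _) (sym (^-distrib-* (v y) (u x) (suc n))) ⟩
            norm x ^ k * norm y ^ k * (v y * u x) ^ suc n ∎))
          where
          interchange : ∀ a b c d → a * b * (c * d) ≈ a * c * (b * d)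
          interchange = solve 4 (λ a b c d → a :* b :* (c :* d) := a :* c :* (b :* d)) refl

          eigen-* : ∀ {a b} → φ a ≈ κ * a → φ b ≈ κ * b → φ (a * b) ≈ κ * κ * (a * b)
          eigen-* {a} {b} φa φb = trans (φ-* a b) (trans (*-cong φa φb)
            (sym (interchange κ κ a b)))


        -- By `recover`, t is the ratio of v - δ u at x to its value at y; as the points (u , v) are
        -- proportional, the coordinates have this same ratio.
        tu′≈u : t * u y ≈ u x
        tu′≈u = *-cancelˡ (*-≉0 β[δ-φδ]≉0 y≉0) (begin
          γ * y * (t * u y)
            ≈⟨ solve 4 (λ c y t w → c :* y :* (t :* w) := c :* (t :* y) :* w) refl γ y t (u y) ⟩
          γ * (t * y) * u y
            ≈⟨ *-congʳ (trans (*-congˡ (sym x≈ty)) (sym (recover x))) ⟩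
          (v x - δ * u x) * u y
            ≈⟨ solve 4 (λ v u u′ d → (v :- d :* u) :* u′ := v :* u′ :- d :* u :* u′) refl _ _ _ _ ⟩
          v x * u y - δ * u x * u y
            ≈⟨ +-congʳ vu′≈v′u ⟩
          v y * u x - δ * u x * u y
            ≈⟨ solve 4 (λ v u u′ d → v :* u :- d :* u :* u′ := (v :- d :* u′) :* u) refl _ _ _ _ ⟩
          (v y - δ * u y) * u x
            ≈⟨ *-congʳ (recover y) ⟩
          γ * y * u x ∎)
          where γ = β * (δ - φ δ)

        tv′≈v : t * v y ≈ v x
        tv′≈v = *-cancelˡ (*-≉0 β[δ-φδ]≉0 y≉0) (begin
          γ * y * (t * v y)
            ≈⟨ solve 4 (λ c y t w → c :* y :* (t :* w) := c :* (t :* y) :* w) refl γ y t (v y) ⟩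
          γ * (t * y) * v y
            ≈⟨ *-congʳ (trans (*-congˡ (sym x≈ty)) (sym (recover x))) ⟩
          (v x - δ * u x) * v y
            ≈⟨ solve 4 (λ v u v′ d → (v :- d :* u) :* v′ := v :* v′ :- d :* (v′ :* u)) refl _ _ _ _ ⟩
          v x * v y - δ * (v y * u x)
            ≈⟨ +-congˡ (-‿cong (*-congˡ vu′≈v′u)) ⟨
          v x * v y - δ * (v x * u y)
            ≈⟨ solve 4 (λ v v′ u′ d → v :* v′ :- d :* (v :* u′) := (v′ :- d :* u′) :* v) refl _ _ _ _ ⟩
          (v y - δ * u y) * v x
            ≈⟨ *-congʳ (recover y) ⟩
          γ * y * v x ∎)
          where γ = β * (δ - φ δ)

        fixed : ∀ {a b} → φ a ≈ κ * a → φ b ≈ κ * b → b ≉ 0# → t * b ≈ a → φ t ≈ t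
        fixed {a} {b} φa φb b≉0 tb≈a = *-cancelʳ (*-≉0 κ≉0 b≉0) (begin
          φ t * (κ * b)  ≈⟨ *-congˡ φb ⟨
          φ t * φ b      ≈⟨ φ-* t b ⟨
          φ (t * b)      ≈⟨ φ-cong tb≈a ⟩
          φ a            ≈⟨ φa ⟩
          κ * a          ≈⟨ *-congˡ tb≈a ⟨
          κ * (t * b)    ≈⟨ solve 3 (λ a b c → a :* (b :* c) := b :* (a :* c)) refl κ t b ⟩
          t * (κ * b)    ∎)

        φt≈t : φ t ≈ t
        -- The coordinates of y ≠ 0 cannot both vanish, and a nonvanishing one exhibits t as a ratio
        -- within one eigenspace.
        φt≈t with u y ≟ 0#
        ... | no u′≉0  = fixed (φ-u x) (φ-u y) u′≉0 tu′≈u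
        ... | yes u′≈0 = fixed (φ-v x) (φ-v y) (λ v′≈0 → y≉0 (u,v≈0⇒≈0 u′≈0 v′≈0)) tv′≈v

        t^M≈1 : t ^ M ≈ 1#
        t^M≈1 = fixed⇒^M≈1 (λ t≈0 → x≉0 (trans x≈ty (trans (*-congʳ t≈0) (zeroˡ y)))) φt≈t

        t^e≈1 : t ^ e ≈ 1#
        t^e≈1 = *-cancelʳ (λ fy≈0 → y≉0 (f≈0⇒≈0 fy≈0)) (begin
          t ^ e * f y  ≈⟨ f-homogeneous t^M≈1 y ⟨
          f (t * y)    ≈⟨ f-cong x≈ty ⟨
          f x          ≈⟨ fx≈fy ⟩
          f y          ≈⟨ *-identityˡ _ ⟨
          1# * f y     ∎)

        t≈1 : t ≈ 1#
        t≈1 = coprime⇒trivial (suc n ℕ.* e) gcd≡1 t^M≈1 (^≈1⇒^*≈1 e (suc n) t^e≈1)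

      -- Injectivity implies coprimality.

      -- As β has norm 1, z ↦ φ(β z) is an involution, whose fixed vectors are the solutions of φ g
      -- = β g. Adding an element to its image gives such a vector, as in Hilbert 90.
      symmetrise : Carrier → Carrier
      symmetrise z = z + φ (β * z)

      φ-symmetrise : ∀ z → φ (symmetrise z) ≈ β * symmetrise z
      φ-symmetrise z = begin
        φ (z + φ (β * z))          ≈⟨ ^Q-distrib-+ z _ ⟩
        φ z + φ (φ (β * z))        ≈⟨ +-cong (κβ-expand (φ z)) (φ-involutive _) ⟩
        φ β * β * φ z + β * z      ≈⟨ solve 4 (λ c b y z → c :* b :* y :+ b :* z := b :* (z :+ c :* y))
                                        refl (φ β) β (φ z) z ⟩
        β * (z + φ β * φ z)        ≈⟨ *-congˡ (+-congˡ (φ-* β z)) ⟨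
        β * symmetrise z           ∎

      -- `symmetrise 1#` vanishes when β = -1, so δ is the alternative; if both vanished, δ would be
      -- fixed by φ.
      β-eigenvector : ∃ λ g → g ≉ 0# × φ g ≈ β * g
      β-eigenvector with symmetrise 1# ≟ 0# | symmetrise δ ≟ 0#
      ... | no 1≉  | _       = _ , 1≉ , φ-symmetrise 1#
      ... | yes _  | no δ≉   = _ , δ≉ , φ-symmetrise δ
      ... | yes 1≈ | yes δ≈  = contradiction (*-cancelˡ (^-≉0 Q β≉0) (+-cancelˡ δ _ _ (begin
        δ + φ β * φ δ      ≈⟨ +-congˡ (φ-* β δ) ⟨
        symmetrise δ       ≈⟨ δ≈ ⟩
        0#                 ≈⟨ zeroʳ δ ⟨
        δ * 0#             ≈⟨ *-congˡ 1≈ ⟨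
        δ * symmetrise 1#  ≈⟨ *-congˡ (+-congˡ (φ-cong (*-identityʳ β))) ⟩
        δ * (1# + φ β)     ≈⟨ distribˡ δ 1# (φ β) ⟩
        δ * 1# + δ * φ β   ≈⟨ +-cong (*-identityʳ δ) (*-comm δ (φ β)) ⟩
        δ + φ β * δ        ∎))) δ∉fixed

      -- If t^(ne) = 1 in F_Q, then t^n is an e-th root of 1, hence trivial, and t is an n-th root
      -- of 1.
      injective⇒coprime : (∀ x y → f x ≈ f y → x ≈ y) → gcd (suc n ℕ.* (suc n ℕ.+ 2 ℕ.* k)) M ≡ 1
      injective⇒coprime f-inj = trivial-roots⇒coprime (suc n ℕ.* e) λ {t} t^M≈1 t^ne≈1 →
        n-trivial t^M≈1 (e-trivial (trans (^-comm t (suc n) M) (trans (^-congˡ (suc n) t^M≈1) (1^ (suc n))))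
          (trans (^-assocʳ t (suc n) e) t^ne≈1))
        where
        e = suc n ℕ.+ 2 ℕ.* k

        e-trivial : ∀ {t} → t ^ M ≈ 1# → t ^ e ≈ 1# → t ≈ 1#
        e-trivial {t} t^M≈1 t^e≈1 = trans (sym (*-identityʳ t)) (f-inj _ _ (begin
          f (t * 1#)    ≈⟨ f-homogeneous t^M≈1 1# ⟩
          t ^ e * f 1#  ≈⟨ *-congʳ t^e≈1 ⟩
          1# * f 1#     ≈⟨ *-identityˡ _ ⟩
          f 1#          ∎))

        -- For t in F_Q, conjugating (t - δ) g gives β (t - φ δ) g; subtracting β (t - δ) g removes
        -- t and leaves `w`.
        g w : Carrier
        g = proj₁ β-eigenvector
        w = β * (δ - φ δ) * g

        w≉0 : w ≉ 0#
        w≉0 = *-≉0 β[δ-φδ]≉0 (proj₁ (proj₂ β-eigenvector))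

        -- The point whose coordinates (u , v) are (w , t w).
        point : Carrier → Carrier
        point t = (t - δ) * g

        φ-point : ∀ {t} → φ t ≈ t → φ (point t) ≈ (t - φ δ) * (β * g)
        φ-point {t} φt≈t = trans (φ-* _ _) (*-cong (trans (φ-- t δ) (+-congʳ φt≈t)) (proj₂ (proj₂ β-eigenvector)))

        u-point : ∀ {t} → φ t ≈ t → u (point t) ≈ w
        u-point {t} φt≈t = trans (+-congʳ (φ-point φt≈t))
          (solve 5 (λ t d c b g → (t :- c) :* (b :* g) :- b :* ((t :- d) :* g) := b :* (d :- c) :* g)
            refl t δ (φ δ) β g)

        v-point : ∀ {t} → φ t ≈ t → v (point t) ≈ t * w
        v-point {t} φt≈t = trans (+-congʳ (*-congˡ (φ-point φt≈t)))
          (solve 5 (λ t d c b g → d :* ((t :- c) :* (b :* g)) :- b :* c :* ((t :- d) :* g)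
            := t :* (b :* (d :- c) :* g)) refl t δ (φ δ) β g)

        point-≉0 : ∀ {t} → φ t ≈ t → point t ≉ 0#
        point-≉0 φt≈t p≈0 = w≉0 (trans (sym (u-point φt≈t)) (trans (u-cong p≈0) u0≈0))

        -- Among n-th roots of 1, the value depends on t only through the norm factor.
        f-point : ∀ {t} → φ t ≈ t → t ^ suc n ≈ 1# →
          f (point t) ≈ norm (point t) ^ k * (w ^ suc n - δ * w ^ suc n)
        f-point {t} φt≈t t^n≈1 = *-congˡ (+-cong v-part (-‿cong (*-congˡ (^-congˡ (suc n) (u-point φt≈t)))))
          where
          v-part : v (point t) ^ suc n ≈ w ^ suc n
          v-part = trans (^-congˡ (suc n) (v-point φt≈t)) (trans (^-distrib-* t w (suc n))
            (trans (*-congʳ t^n≈1) (*-identityˡ _)))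

        -- A scalar s in F_Q compensates the norm factors, so injectivity gives s (point t) = point
        -- 1. The u-coordinates, both multiples of w, yield s = 1; then the v-coordinates yield t =
        -- 1.
        n-trivial : ∀ {t} → t ^ M ≈ 1# → t ^ suc n ≈ 1# → t ≈ 1#
        n-trivial {t} t^M≈1 t^n≈1 = *-cancelʳ w≉0 (begin
          t * w          ≈⟨ v-point φt≈t ⟨
          v (point t)    ≈⟨ v-cong (point-t≈point-1 root) ⟩
          v (point 1#)   ≈⟨ v-point φ1≈1 ⟩
          1# * w         ∎)
          where
          φ1≈1 : φ 1# ≈ 1#
          φ1≈1 = 1^ Q

          φt≈t : φ t ≈ t
          φt≈t = ^M≈1⇒fixed t^M≈1

          φ-norm^k : ∀ z → φ (norm z ^ k) ≈ norm z ^ k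
          φ-norm^k z = trans (φ-^ (norm z) k) (^-congˡ k (φ-norm z))

          root : ∃ λ s → s ^ M ≈ 1# × s ^ e * norm (point t) ^ k ≈ norm (point 1#) ^ k
          root = fixed-ratio-root e (trivial-roots⇒coprime e e-trivial) (φ-norm^k _) (φ-norm^k _)
            (^-≉0 k (norm-≉0 (point-≉0 φ1≈1))) (^-≉0 k (norm-≉0 (point-≉0 φt≈t)))

          point-t≈point-1 : (∃ λ s → s ^ M ≈ 1# × s ^ e * norm (point t) ^ k ≈ norm (point 1#) ^ k) →
            point t ≈ point 1#
          point-t≈point-1 (s , s^M≈1 , s^eNt≈N1) = begin
            point t       ≈⟨ *-identityˡ _ ⟨
            1# * point t  ≈⟨ *-congʳ s≈1 ⟨
            s * point t   ≈⟨ s*point-t≈point-1 ⟩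
            point 1#      ∎
            where
            s*point-t≈point-1 : s * point t ≈ point 1#
            s*point-t≈point-1 = f-inj _ _ (begin
              f (s * point t)
                ≈⟨ f-homogeneous s^M≈1 (point t) ⟩
              s ^ e * f (point t)
                ≈⟨ *-congˡ (f-point φt≈t t^n≈1) ⟩
              s ^ e * (norm (point t) ^ k * (w ^ suc n - δ * w ^ suc n))
                ≈⟨ *-assoc _ _ _ ⟨
              s ^ e * norm (point t) ^ k * (w ^ suc n - δ * w ^ suc n)
                ≈⟨ *-congʳ s^eNt≈N1 ⟩
              norm (point 1#) ^ k * (w ^ suc n - δ * w ^ suc n)
                ≈⟨ f-point φ1≈1 (1^ (suc n)) ⟨
              f (point 1#) ∎)

            s≈1 : s ≈ 1#
            s≈1 = *-cancelʳ w≉0 (begin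
              s * w            ≈⟨ *-congˡ (u-point φt≈t) ⟨
              s * u (point t)  ≈⟨ u-homogeneous s^M≈1 (point t) ⟨
              u (s * point t)  ≈⟨ u-cong s*point-t≈point-1 ⟩
              u (point 1#)     ≈⟨ u-point φ1≈1 ⟩
              w                ≈⟨ *-identityˡ w ⟨
              1# * w           ∎)

-- Prime powers and the theorem.

primePower>1 : ∀ {Q} → IsPrimePower Q → 1 ℕ.< Q
primePower>1 (p , suc m , p-prime , _ , ≡.refl) =
  ℕ.<-≤-trans 1<p (ℕ.m≤m*n p (p ℕ.^ m) {{ℕ.m^n≢0 p m}})
  where
  1<p : 1 ℕ.< p
  1<p = ℕ.nonTrivial⇒n>1 p {{prime⇒nonTrivial p-prime}}

  instance
    _ = ℕ.>-nonZero (ℕ.<-trans (ℕ.s≤s ℕ.z≤n) 1<p)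

module _ {c ℓ : Level} (F : CommutativeRing c ℓ) where
  open CommutativeRing F hiding (zero)
  open CommutativeRingTheory F

  primePower^-distrib-+ : ∀ {q} → IsPrimePower (suc q) → IsFiniteFieldOfOrder F (suc q ℕ.* suc q) →
    ∀ x y → (x + y) ^ suc q ≈ x ^ suc q + y ^ suc q
  primePower^-distrib-+ (p , m , p-prime , _ , Q≡p^m) isFiniteField x y =
    trans (^-congʳ _ Q≡p^m) (trans
      (^p^-distrib-+ p-prime (characteristic p (m ℕ.+ m) order≡p^2m) m x y)
      (sym (+-cong (^-congʳ x Q≡p^m) (^-congʳ y Q≡p^m))))
    where
    open FiniteFieldTheory F isFiniteField using (characteristic)
    order≡p^2m = ≡.trans (≡.cong₂ ℕ._*_ Q≡p^m Q≡p^m) (≡.sym (ℕ.^-distribˡ-+-* p m m))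

open import Data.Nat using (_*_; _+_; _∸_; _<_)

theorem1p2 : ∀ {c ℓ : Level} (Q : ℕ) → IsPrimePower Q →
    (F : CommutativeRing c ℓ) → IsFiniteFieldOfOrder F (Q * Q) →
    (n k : ℕ) → 0 < n →
    (β δ : CommutativeRing.Carrier F) →
    CommutativeRing._≈_ F (pow F β (Q + 1)) (CommutativeRing.1# F) →
    ¬ (CommutativeRing._≈_ F (pow F δ Q) δ) →
    Permutes F (fPoly F Q n k β δ) ⇔ (gcd (n * (n + 2 * k)) (Q ∸ 1) ≡ 1)
theorem1p2 zero pp = contradiction (primePower>1 pp) λ ()
theorem1p2 (suc zero) pp = contradiction (primePower>1 pp) (ℕ.<-irrefl ≡.refl)
theorem1p2 (suc (suc q)) pp F isFiniteField (suc n) k _ β δ β^[Q+1]≈1 δ^Q≉δ = mk⇔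
  (λ (inj , _) → injective⇒coprime λ x y fx≈fy →
    inj x y (trans (fPoly≈f x) (trans fx≈fy (sym (fPoly≈f y)))))
  (λ gcd≡1 → injective⇒permutes (fPoly F Q (suc n) k β δ)
    (λ {x} {y} x≈y → trans (fPoly≈f x) (trans (f-cong x≈y) (sym (fPoly≈f y))))
    (λ x y fx≈fy → coprime⇒injective gcd≡1 x y
      (trans (sym (fPoly≈f x)) (trans fx≈fy (fPoly≈f y)))))
  where
  Q = suc (suc q)

  open CommutativeRing F using (_≈_; 1#; trans; sym; reflexive; *-congˡ; *-identityʳ)
    renaming (_*_ to _·_)
  open CommutativeRingTheory F
  open FiniteFieldTheory F isFiniteField using (injective⇒permutes)
  open QuadraticExtension F {q} isFiniteField hiding (Q)

  β^Qβ≈1 : β ^ Q · β ≈ 1#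
  β^Qβ≈1 = trans (*-congˡ (sym (*-identityʳ β))) (trans (sym (^-homo-* β Q 1))
    (trans (reflexive (≡.sym (pow≡^ β (Q + 1)))) β^[Q+1]≈1))

  open Conjugation (primePower^-distrib-+ F pp isFiniteField)
  open Polynomial n k β δ β^Qβ≈1 (λ δ^Q≈δ → δ^Q≉δ (trans (reflexive (pow≡^ δ Q)) δ^Q≈δ))
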